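{- Let $p$ be a prime and let $k\ge2$. Suppose that, locally at $p$, $\alpha=\beta*\gamma$, where $\beta$ is a positive function of degree 1 at $p$ and $\gamma$ is the convolution inverse of a positive function of degree $k-1$ at $p$, and that $\alpha$ is non-trivial and this product is in normal form. Let $F_n=\alpha(p^n)$, let $t'_1=\beta(p)$, let $F''_j=\gamma(p^j)$, and let $s''_j$ $(j\ge1)$ be the parameters at $p$ of $\gamma^{ -1}$, with $s''_0=-1$. Then for all $n\ge0$, $$F_n=-\sum_{j=0}^n(t'_1)^{n-j}s''_j=\sum_{j=0}^n(t'_1)^{n-j}F''_j.$$
   Context: A multiplicative arithmetic function is a function $\alpha:\mathbb{N}_{\ge1}\to\mathbb{C}$, not identically zero, with $\alpha(mn)=\alpha(m)\alpha(n)$ whenever $\gcd(m,n)=1$. Dirichlet convolution is $(\alpha*\beta)(n)=\sum_{d\mid n}\alpha(d)\beta(n/d)$. Generalized Fibonacci polynomials: $F_0=1$ and, for $n\ge1$, $F_n(t_1,\dots,t_n)=\sum\binom{a_1+\dots+a_n}{a_1,\dots,a_n}t_1^{a_1}\cdots t_n^{a_n}$, the sum being over tuples of non-negative integers with $\sum_j ja_j=n$. The parameters of a multiplicative function $\alpha$ at $p$ are the unique complex numbers $t_1,t_2,\dots$ such that $F_n(t_1,\dots,t_n)=\alpha(p^n)$ for all $n\ge0$. The degree of $\alpha$ at $p$ is $k$ if $t_k\ne0$ and $t_j=0$ for $j>k$. A function has degree 1 at $p$ iff its values on powers of $p$ are $p^n\mapsto b^n$ with $b\neq0$. A positive function of degree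 $m$ at $p$ is, on powers of $p$, a convolution product of $m$ functions of degree 1 at $p$. A convolution product of degree-1 functions and inverses of degree-1 functions is in normal form if no two factors are mutually inverse (on powers of $p$). -}

module Defs where

open import Level using (0ℓ; _⊔_)
open import Algebra.Bundles using (CommutativeRing)
open import Data.Product using (_×_; _,_; ∃)
open import Data.Fin.Base as Fin using (toℕ)
open import Data.Nat.Base as ℕ using (ℕ; zero; suc; NonZero; _≤_; _!)
import Data.Nat.Properties as ℕ
open import Data.Nat.Divisibility using (_∣?_; quotient; quotient≢0)
open import Data.Nat.DivMod using (_/_)
open import Data.Nat.GCD using (gcd)
open import Data.Rational as ℚ using (ℚ; 0ℚ; 1ℚ; ½; ∣_∣; Positive; positive; 1/_)
import Data.Rational.Properties as ℚ
import Data.Rational.Solver as ℚSolver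
open import Data.Vec.Functional as Vector using (Vector; _∷_; [])
open import Relation.Nullary using (¬_; yes; no)
open import Relation.Binary.PropositionalEquality as ≡
  using (_≡_; _≢_; cong; subst)
import Algebra.Properties.Monoid.Sum
import Algebra.Properties.CommutativeSemigroup
import Algebra.Properties.Ring
import Algebra.Properties.Monoid.Mult
import Algebra.Properties.Semiring.Exp

-- The real numbers: Cauchy sequences of rationals, identified when their
-- difference tends to 0.

Eventually : (ℕ → Set) → Set
Eventually P = ∃ λ N → ∀ n → N ≤ n → P n

Eventually₂ : (ℕ → ℕ → Set) → Set
Eventually₂ P = ∃ λ N → ∀ m n → N ≤ m → N ≤ n → P m n

-- Without η, comparing two reals never unfolds the Cauchy proofs.
record ℝ : Set where
  no-eta-equality
  field
    seq    : ℕ → ℚ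
    cauchy : ∀ ε → 0ℚ ℚ.< ε → Eventually₂ λ m n → ∣ seq m ℚ.- seq n ∣ ℚ.< ε

open ℝ

infix 4 _≈ᴿ_

record _≈ᴿ_ (x y : ℝ) : Set where
  no-eta-equality
  field
    close : ∀ ε → 0ℚ ℚ.< ε → Eventually λ n → ∣ seq x n ℚ.- seq y n ∣ ℚ.< ε

open _≈ᴿ_

module RealLemmas where
  open import Data.Rational using (_+_; _-_; _*_; -_; _<_)
  open ℚSolver.+-*-Solver using (solve; _:+_; _:*_; _:-_; :-_; _:=_)

  infixr 4 _∩_ _∩₂_

  _∩_ : ∀ {P Q} → Eventually P → Eventually Q → Eventually λ n → P n × Q n
  (M , p) ∩ (N , q) = M ℕ.⊔ N , λ n h →
    p n (ℕ.m⊔n≤o⇒m≤o M N h) , q n (ℕ.m⊔n≤o⇒n≤o M N h)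

  _∩₂_ : ∀ {P Q} → Eventually₂ P → Eventually₂ Q → Eventually₂ λ m n → P m n × Q m n
  (M , p) ∩₂ (N , q) = M ℕ.⊔ N , λ m n h k →
    p m n (ℕ.m⊔n≤o⇒m≤o M N h) (ℕ.m⊔n≤o⇒m≤o M N k) ,
    q m n (ℕ.m⊔n≤o⇒n≤o M N h) (ℕ.m⊔n≤o⇒n≤o M N k)

  map : ∀ {P Q : ℕ → Set} → (∀ n → P n → Q n) → Eventually P → Eventually Q
  map f (N , p) = N , λ n h → f n (p n h)

  map₂ : ∀ {P Q : ℕ → ℕ → Set} → (∀ m n → P m n → Q m n) → Eventually₂ P → Eventually₂ Q
  map₂ f (N , p) = N , λ m n h k → f m n (p m n h k)

  left : ∀ {P : ℕ → Set} → Eventually P → Eventually₂ λ m n → P m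
  left (N , p) = N , λ m n h k → p m h

  right : ∀ {P : ℕ → Set} → Eventually P → Eventually₂ λ m n → P n
  right (N , p) = N , λ m n h k → p n k

  half : ℚ → ℚ
  half ε = ½ * ε

  half>0 : ∀ {ε} → 0ℚ < ε → 0ℚ < half ε
  half>0 {ε} ε>0 = ℚ.positive⁻¹ _ {{ℚ.pos*pos⇒pos ½ ε {{positive ε>0}}}}

  half+half : ∀ ε → half ε + half ε ≡ ε
  half+half ε = ≡.trans (≡.sym (ℚ.*-distribʳ-+ ε ½ ½)) (ℚ.*-identityˡ ε)

  scaled : ∀ K → 0ℚ < K → ∀ ε → 0ℚ < ε → ∃ λ δ → 0ℚ < δ × K * δ ≡ ε
  scaled K K>0 ε ε>0 = 1/ K * ε ,
    ℚ.positive⁻¹ _ {{ℚ.pos*pos⇒pos (1/ K) {{ℚ.1/pos⇒pos K}} ε {{positive ε>0}}}} ,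
    ≡.trans (≡.sym (ℚ.*-assoc K (1/ K) ε))
      (≡.trans (cong (_* ε) (ℚ.*-inverseʳ K)) (ℚ.*-identityˡ ε))
    where instance
      K+ : Positive K
      K+ = positive K>0
      K≢0 : ℚ.NonZero K
      K≢0 = ℚ.pos⇒nonZero K

  split : ∀ a b {c ε} → c ≡ a + b → ∣ a ∣ < half ε → ∣ b ∣ < half ε → ∣ c ∣ < ε
  split a b {ε = ε} ≡.refl h k =
    subst (∣ a + b ∣ <_) (half+half ε) (ℚ.≤-<-trans (ℚ.∣p+q∣≤∣p∣+∣q∣ a b) (ℚ.+-mono-< h k))

  scale : ∀ x d {K δ ε} → ∣ x ∣ < K → 0ℚ < K → ∣ d ∣ < δ → K * δ ≡ ε → ∣ x * d ∣ < ε
  scale x d {K} {δ} x<K K>0 d<δ ≡.refl = begin-strict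
    ∣ x * d ∣     ≡⟨ ℚ.∣p*q∣≡∣p∣*∣q∣ x d ⟩
    ∣ x ∣ * ∣ d ∣ ≤⟨ ℚ.*-monoʳ-≤-nonNeg ∣ d ∣ {{ℚ.nonNegative (ℚ.0≤∣p∣ d)}} (ℚ.<⇒≤ x<K) ⟩
    K * ∣ d ∣     <⟨ ℚ.*-monoʳ-<-pos K {{positive K>0}} d<δ ⟩
    K * δ         ∎
    where open ℚ.≤-Reasoning

  ∣0∣<ε : ∀ {a ε} → a ≡ 0ℚ → 0ℚ < ε → ∣ a ∣ < ε
  ∣0∣<ε ≡.refl ε>0 = ε>0

  bounded : ∀ x → ∃ λ K → 0ℚ < K × Eventually λ n → ∣ seq x n ∣ < K
  bounded x with cauchy x 1ℚ (ℚ.positive⁻¹ 1ℚ)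
  ... | N , h = 1ℚ + ∣ seq x N ∣ ,
    ℚ.+-mono-<-≤ (ℚ.positive⁻¹ 1ℚ) (ℚ.0≤∣p∣ (seq x N)) ,
    N , λ n N≤n → begin-strict
      ∣ seq x n ∣                        ≡⟨ cong ∣_∣ (solve 2 (λ a b → a := (a :- b) :+ b) ≡.refl (seq x n) (seq x N)) ⟩
      ∣ (seq x n - seq x N) + seq x N ∣  ≤⟨ ℚ.∣p+q∣≤∣p∣+∣q∣ (seq x n - seq x N) (seq x N) ⟩
      ∣ seq x n - seq x N ∣ + ∣ seq x N ∣ <⟨ ℚ.+-monoˡ-< ∣ seq x N ∣ (h n N N≤n ℕ.≤-refl) ⟩
      1ℚ + ∣ seq x N ∣                   ∎
    where open ℚ.≤-Reasoning

  add-diff : ∀ a b c d → (a + b) - (c + d) ≡ (a - c) + (b - d)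
  add-diff = solve 4 (λ a b c d → (a :+ b) :- (c :+ d) := (a :- c) :+ (b :- d)) ≡.refl

  mul-diff : ∀ a b c d → (a * b) - (c * d) ≡ a * (b - d) + d * (a - c)
  mul-diff = solve 4 (λ a b c d → (a :* b) :- (c :* d) := a :* (b :- d) :+ d :* (a :- c)) ≡.refl

  mul-close : ∀ a b c d {K L δ η ε} →
              ∣ a ∣ < K → 0ℚ < K → ∣ b - d ∣ < δ → K * δ ≡ half ε →
              ∣ d ∣ < L → 0ℚ < L → ∣ a - c ∣ < η → L * η ≡ half ε →
              ∣ (a * b) - (c * d) ∣ < ε
  mul-close a b c d h K>0 h′ Kδ k L>0 k′ Lη =
    split (a * (b - d)) (d * (a - c)) (mul-diff a b c d)
      (scale a (b - d) h K>0 h′ Kδ) (scale d (a - c) k L>0 k′ Lη)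

  neg-diff : ∀ a b → ∣ (- a) - (- b) ∣ ≡ ∣ a - b ∣
  neg-diff a b = ≡.trans
    (cong ∣_∣ (solve 2 (λ a b → (:- a) :- (:- b) := :- (a :- b)) ≡.refl a b)) (ℚ.∣-p∣≡∣p∣ (a - b))

  swap-diff : ∀ a b → ∣ b - a ∣ ≡ ∣ a - b ∣
  swap-diff a b = ≡.trans
    (cong ∣_∣ (solve 2 (λ a b → b :- a := :- (a :- b)) ≡.refl a b)) (ℚ.∣-p∣≡∣p∣ (a - b))

open RealLemmas

constᴿ : ℚ → ℝ
constᴿ q .seq _ = q
constᴿ q .cauchy ε ε>0 = 0 , λ m n _ _ → ∣0∣<ε (ℚ.+-inverseʳ q) ε>0

infixl 6 _+ᴿ_
infixl 7 _*ᴿ_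
infix  8 -ᴿ_

_+ᴿ_ : ℝ → ℝ → ℝ
(x +ᴿ y) .seq n = seq x n ℚ.+ seq y n
(x +ᴿ y) .cauchy ε ε>0 =
  map₂ (λ m n (h , k) → split (seq x m ℚ.- seq x n) (seq y m ℚ.- seq y n) (add-diff (seq x m) (seq y m) (seq x n) (seq y n)) h k)
    (cauchy x (half ε) (half>0 ε>0) ∩₂ cauchy y (half ε) (half>0 ε>0))

_*ᴿ_ : ℝ → ℝ → ℝ
(x *ᴿ y) .seq n = seq x n ℚ.* seq y n
(x *ᴿ y) .cauchy ε ε>0 =
  let K , K>0 , x<K = bounded x
      L , L>0 , y<L = bounded y
      δ , δ>0 , Kδ = scaled K K>0 (half ε) (half>0 ε>0)
      η , η>0 , Lη = scaled L L>0 (half ε) (half>0 ε>0)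
  in map₂ (λ m n (h , k , h′ , k′) →
      mul-close (seq x m) (seq y m) (seq x n) (seq y n) h K>0 h′ Kδ k L>0 k′ Lη)
    (left x<K ∩₂ right y<L ∩₂ cauchy y δ δ>0 ∩₂ cauchy x η η>0)

-ᴿ_ : ℝ → ℝ
(-ᴿ x) .seq n = ℚ.- seq x n
(-ᴿ x) .cauchy ε ε>0 =
  map₂ (λ m n → subst (ℚ._< ε) (≡.sym (neg-diff (seq x m) (seq x n)))) (cauchy x ε ε>0)

module RealRing where

  pointwise : ∀ {x y} → (∀ n → seq x n ≡ seq y n) → x ≈ᴿ y
  pointwise {x} {y} eq .close ε ε>0 = 0 , λ n _ →
    ∣0∣<ε (≡.trans (cong (ℚ._- seq y n) (eq n)) (ℚ.+-inverseʳ (seq y n))) ε>0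

  sym : ∀ {x y} → x ≈ᴿ y → y ≈ᴿ x
  sym {x} {y} e .close ε ε>0 =
    map (λ n → subst (ℚ._< ε) (≡.sym (swap-diff (seq x n) (seq y n)))) (close e ε ε>0)

  trans : ∀ {x y z} → x ≈ᴿ y → y ≈ᴿ z → x ≈ᴿ z
  trans {x} {y} {z} e f .close ε ε>0 =
    map (λ n (h , k) → split (seq x n ℚ.- seq y n) (seq y n ℚ.- seq z n) (telescope (seq x n) (seq y n) (seq z n)) h k)
      (close e (half ε) (half>0 ε>0) ∩ close f (half ε) (half>0 ε>0))
    where
    open ℚSolver.+-*-Solver
    telescope : ∀ a b c → a ℚ.- c ≡ (a ℚ.- b) ℚ.+ (b ℚ.- c)
    telescope = solve 3 (λ a b c → a :- c := (a :- b) :+ (b :- c)) ≡.refl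

  +-cong : ∀ {x y u v} → x ≈ᴿ y → u ≈ᴿ v → (x +ᴿ u) ≈ᴿ (y +ᴿ v)
  +-cong {x} {y} {u} {v} e f .close ε ε>0 =
    map (λ n (h , k) → split (seq x n ℚ.- seq y n) (seq u n ℚ.- seq v n) (add-diff (seq x n) (seq u n) (seq y n) (seq v n)) h k)
      (close e (half ε) (half>0 ε>0) ∩ close f (half ε) (half>0 ε>0))

  *-cong : ∀ {x y u v} → x ≈ᴿ y → u ≈ᴿ v → (x *ᴿ u) ≈ᴿ (y *ᴿ v)
  *-cong {x} {y} {u} {v} e f .close ε ε>0 =
    let K , K>0 , x<K = bounded x
        L , L>0 , v<L = bounded v
        δ , δ>0 , Kδ = scaled K K>0 (half ε) (half>0 ε>0)
        η , η>0 , Lη = scaled L L>0 (half ε) (half>0 ε>0)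
    in map (λ n (h , k , h′ , k′) →
        mul-close (seq x n) (seq u n) (seq y n) (seq v n) h K>0 h′ Kδ k L>0 k′ Lη)
      (x<K ∩ v<L ∩ close f δ δ>0 ∩ close e η η>0)

  -‿cong : ∀ {x y} → x ≈ᴿ y → (-ᴿ x) ≈ᴿ (-ᴿ y)
  -‿cong {x} {y} e .close ε ε>0 =
    map (λ n → subst (ℚ._< ε) (≡.sym (neg-diff (seq x n) (seq y n)))) (close e ε ε>0)

ℝ-commutativeRing : CommutativeRing 0ℓ 0ℓ
ℝ-commutativeRing = record
  { Carrier = ℝ
  ; _≈_ = _≈ᴿ_
  ; _+_ = _+ᴿ_
  ; _*_ = _*ᴿ_
  ; -_ = -ᴿ_
  ; 0# = constᴿ 0ℚ
  ; 1# = constᴿ 1ℚ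
  ; isCommutativeRing = record
    { isRing = record
      { +-isAbelianGroup = record
        { isGroup = record
          { isMonoid = record
            { isSemigroup = record
              { isMagma = record
                { isEquivalence = record
                  { refl = pointwise λ n → ≡.refl ; sym = sym ; trans = trans }
                ; ∙-cong = +-cong }
              ; assoc = λ x y z → pointwise λ n → ℚ.+-assoc (seq x n) (seq y n) (seq z n) }
            ; identity = (λ x → pointwise λ n → ℚ.+-identityˡ (seq x n))
                       , (λ x → pointwise λ n → ℚ.+-identityʳ (seq x n)) }
          ; inverse = (λ x → pointwise λ n → ℚ.+-inverseˡ (seq x n))
                    , (λ x → pointwise λ n → ℚ.+-inverseʳ (seq x n))
          ; ⁻¹-cong = -‿cong }
        ; comm = λ x y → pointwise λ n → ℚ.+-comm (seq x n) (seq y n) }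
      ; *-cong = *-cong
      ; *-assoc = λ x y z → pointwise λ n → ℚ.*-assoc (seq x n) (seq y n) (seq z n)
      ; *-identity = (λ x → pointwise λ n → ℚ.*-identityˡ (seq x n))
                   , (λ x → pointwise λ n → ℚ.*-identityʳ (seq x n))
      ; distrib = (λ x y z → pointwise λ n → ℚ.*-distribˡ-+ (seq x n) (seq y n) (seq z n))
                , (λ x y z → pointwise λ n → ℚ.*-distribʳ-+ (seq x n) (seq y n) (seq z n)) }
    ; *-comm = λ x y → pointwise λ n → ℚ.*-comm (seq x n) (seq y n) } }
  where open RealRing

-- R[i] with i² = -1

module AdjoinI {c ℓ} (R : CommutativeRing c ℓ) where
  open CommutativeRing R
  open Algebra.Properties.Ring ring 
    using (-0#≈0#; -‿+-comm; [y-z]x≈yx-zx; x[y-z]≈xy-xz)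
  open Algebra.Properties.CommutativeSemigroup +-commutativeSemigroup using (interchange)
  open import Relation.Binary.Reasoning.Setoid setoid


  record Complex : Set c where
    constructor _+i_
    field
      re im : Carrier

  open Complex

  record _≈ᶜ_ (z w : Complex) : Set ℓ where
    constructor _,_
    field
      re≈ : re z ≈ re w
      im≈ : im z ≈ im w

  private
    -‿regroup : ∀ x y z w → (x + y) - (z + w) ≈ (x - z) + (y - w)
    -‿regroup x y z w = trans (+-congˡ (sym (-‿+-comm z w))) (interchange x y (- z) (- w))

    assoc-re : ∀ a b c d e f → (a * c - b * d) * e - (a * d + b * c) * f
                             ≈ a * (c * e - d * f) - b * (c * f + d * e)
    assoc-re a b c d e f = begin
      (a * c - b * d) * e - (a * d + b * c) * f
        ≈⟨ +-cong ([y-z]x≈yx-zx e _ _) (-‿cong (distribʳ f _ _)) ⟩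
      (a * c * e - b * d * e) - (a * d * f + b * c * f)
        ≈⟨ -‿regroup _ _ _ _ ⟩
      (a * c * e - a * d * f) + (- (b * d * e) - b * c * f)
        ≈⟨ +-congˡ (trans (+-comm _ _) (-‿+-comm _ _)) ⟩
      (a * c * e - a * d * f) - (b * c * f + b * d * e)
        ≈⟨ +-cong (+-cong (*-assoc a c e) (-‿cong (*-assoc a d f)))
             (-‿cong (+-cong (*-assoc b c f) (*-assoc b d e))) ⟩
      (a * (c * e) - a * (d * f)) - (b * (c * f) + b * (d * e))
        ≈⟨ +-cong (x[y-z]≈xy-xz a _ _) (-‿cong (distribˡ b _ _)) ⟨
      a * (c * e - d * f) - b * (c * f + d * e) ∎

    assoc-im : ∀ a b c d e f → (a * c - b * d) * f + (a * d + b * c) * e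
                             ≈ a * (c * f + d * e) + b * (c * e - d * f)
    assoc-im a b c d e f = begin
      (a * c - b * d) * f + (a * d + b * c) * e
        ≈⟨ +-cong ([y-z]x≈yx-zx f _ _) (distribʳ e _ _) ⟩
      (a * c * f - b * d * f) + (a * d * e + b * c * e)
        ≈⟨ interchange _ _ _ _ ⟩
      (a * c * f + a * d * e) + (- (b * d * f) + b * c * e)
        ≈⟨ +-congˡ (+-comm _ _) ⟩
      (a * c * f + a * d * e) + (b * c * e - b * d * f)
        ≈⟨ +-cong (+-cong (*-assoc a c f) (*-assoc a d e))
             (+-cong (*-assoc b c e) (-‿cong (*-assoc b d f))) ⟩
      (a * (c * f) + a * (d * e)) + (b * (c * e) - b * (d * f))
        ≈⟨ +-cong (distribˡ a _ _) (x[y-z]≈xy-xz b _ _) ⟨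
      a * (c * f + d * e) + b * (c * e - d * f) ∎

    comm-re : ∀ a b c d → a * c - b * d ≈ c * a - d * b
    comm-re a b c d = +-cong (*-comm a c) (-‿cong (*-comm b d))

    comm-im : ∀ a b c d → a * d + b * c ≈ c * b + d * a
    comm-im a b c d = trans (+-comm _ _) (+-cong (*-comm b c) (*-comm a d))

    distribˡ-re : ∀ a b c d e f → a * (c + e) - b * (d + f) ≈ (a * c - b * d) + (a * e - b * f)
    distribˡ-re a b c d e f =
      trans (+-cong (distribˡ a c e) (-‿cong (distribˡ b d f))) (-‿regroup _ _ _ _)

    distribˡ-im : ∀ a b c d e f → a * (d + f) + b * (c + e) ≈ (a * d + b * c) + (a * f + b * e)
    distribˡ-im a b c d e f =
      trans (+-cong (distribˡ a d f) (distribˡ b c e)) (interchange _ _ _ _)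

    distribʳ-re : ∀ a b c d e f → (c + e) * a - (d + f) * b ≈ (c * a - d * b) + (e * a - f * b)
    distribʳ-re a b c d e f =
      trans (+-cong (distribʳ a c e) (-‿cong (distribʳ b d f))) (-‿regroup _ _ _ _)

    distribʳ-im : ∀ a b c d e f → (c + e) * b + (d + f) * a ≈ (c * b + d * a) + (e * b + f * a)
    distribʳ-im a b c d e f =
      trans (+-cong (distribʳ b c e) (distribʳ a d f)) (interchange _ _ _ _)

    identityˡ-re : ∀ a b → 1# * a - 0# * b ≈ a
    identityˡ-re a b = begin
      1# * a - 0# * b ≈⟨ +-cong (*-identityˡ a) (-‿cong (zeroˡ b)) ⟩
      a - 0#          ≈⟨ +-congˡ -0#≈0# ⟩
      a + 0#          ≈⟨ +-identityʳ a ⟩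
      a               ∎

    identityˡ-im : ∀ a b → 1# * b + 0# * a ≈ b
    identityˡ-im a b = trans (+-cong (*-identityˡ b) (zeroˡ a)) (+-identityʳ b)

    identityʳ-re : ∀ a b → a * 1# - b * 0# ≈ a
    identityʳ-re a b = trans (comm-re a b 1# 0#) (identityˡ-re a b)

    identityʳ-im : ∀ a b → a * 0# + b * 1# ≈ b
    identityʳ-im a b = trans (comm-im a b 1# 0#) (identityˡ-im a b)

  Complex-commutativeRing : CommutativeRing c ℓ
  Complex-commutativeRing = record
    { Carrier = Complex
    ; _≈_ = _≈ᶜ_
    ; _+_ = λ (a +i b) (c +i d) → (a + c) +i (b + d)
    ; _*_ = λ (a +i b) (c +i d) → (a * c - b * d) +i (a * d + b * c)
    ; -_ = λ (a +i b) → (- a) +i (- b)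
    ; 0# = 0# +i 0#
    ; 1# = 1# +i 0#
    ; isCommutativeRing = record
      { isRing = record
        { +-isAbelianGroup = record
          { isGroup = record
            { isMonoid = record
              { isSemigroup = record
                { isMagma = record
                  { isEquivalence = record
                    { refl = refl , refl
                    ; sym = λ (e , f) → sym e , sym f
                    ; trans = λ (e , f) (g , h) → trans e g , trans f h }
                  ; ∙-cong = λ (e , f) (g , h) → +-cong e g , +-cong f h }
                ; assoc = λ (a +i b) (c +i d) (e +i f) → +-assoc a c e , +-assoc b d f }
              ; identity = (λ (a +i b) → +-identityˡ a , +-identityˡ b)
                         , (λ (a +i b) → +-identityʳ a , +-identityʳ b) }
            ; inverse = (λ (a +i b) → -‿inverseˡ a , -‿inverseˡ b)
                      , (λ (a +i b) → -‿inverseʳ a , -‿inverseʳ b)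
            ; ⁻¹-cong = λ (e , f) → -‿cong e , -‿cong f }
          ; comm = λ (a +i b) (c +i d) → +-comm a c , +-comm b d }
        ; *-cong = λ (e , f) (g , h) →
            +-cong (*-cong e g) (-‿cong (*-cong f h)) , +-cong (*-cong e h) (*-cong f g)
        ; *-assoc = λ (a +i b) (c +i d) (e +i f) →
            assoc-re a b c d e f , assoc-im a b c d e f
        ; *-identity = (λ (a +i b) → identityˡ-re a b , identityˡ-im a b)
                     , (λ (a +i b) → identityʳ-re a b , identityʳ-im a b)
        ; distrib = (λ (a +i b) (c +i d) (e +i f) →
                       distribˡ-re a b c d e f , distribˡ-im a b c d e f)
                  , (λ (a +i b) (c +i d) (e +i f) →
                       distribʳ-re a b c d e f , distribʳ-im a b c d e f) }
      ; *-comm = λ (a +i b) (c +i d) → comm-re a b c d , comm-im a b c d } }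

open AdjoinI ℝ-commutativeRing public using ()
  renaming (Complex to ℂ; Complex-commutativeRing to ℂ-commutativeRing)

module Sums {c ℓ} (R : CommutativeRing c ℓ) where
  open CommutativeRing R
  open Algebra.Properties.Monoid.Sum +-monoid public using (sum⁺-syntax; sum-syntax)
  open Algebra.Properties.Monoid.Sum *-monoid public using () renaming (sum to product)
  open Algebra.Properties.Monoid.Mult +-monoid public using () renaming (_×_ to _·_)
  open Algebra.Properties.Semiring.Exp semiring public using (_^_)

module ℕ-Sum = Algebra.Properties.Monoid.Sum ℕ.+-0-monoid
module ℕ-Product = Algebra.Properties.Monoid.Sum ℕ.*-1-monoid

∏!≢0 : ∀ {m} (a : Vector ℕ m) → NonZero (ℕ-Product.sum λ j → a j !)
∏!≢0 {zero}  a = _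
∏!≢0 {suc m} a = ℕ.m*n≢0 _ _ {{a Fin.zero ℕ.!≢0}} {{∏!≢0 λ j → a (Fin.suc j)}}

multinomial : ∀ {m} → Vector ℕ m → ℕ
multinomial a = _/_ (ℕ-Sum.sum a !) (ℕ-Product.sum λ j → a j !) {{∏!≢0 a}}

module ArithmeticFunctions {c ℓ} (R : CommutativeRing c ℓ) where
  open CommutativeRing R
  open Sums R

  ArithmeticFunction : Set c
  ArithmeticFunction = (n : ℕ) .{{_ : NonZero n}} → Carrier

  record IsMultiplicative (α : ArithmeticFunction) : Set ℓ where
    field
      nonzero  : ¬ (∀ n .{{_ : NonZero n}} → α n ≈ 0#)
      multiply : ∀ m n .{{_ : NonZero m}} .{{_ : NonZero n}} → gcd m n ≡ 1 →
                 α (m ℕ.* n) {{ℕ.m*n≢0 m n}} ≈ α m * α n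

  convolutionTerm : ArithmeticFunction → ArithmeticFunction →
                    (n : ℕ) .{{_ : NonZero n}} (d : ℕ) .{{_ : NonZero d}} → Carrier
  convolutionTerm α β n d with d ∣? n
  ... | yes d∣n = α d * β (quotient d∣n) {{quotient≢0 d∣n}}
  ... | no _    = 0#

  infixl 7 _∗_

  _∗_ : ArithmeticFunction → ArithmeticFunction → ArithmeticFunction
  (α ∗ β) n = ∑[ i < n ] convolutionTerm α β n (suc (toℕ i))

  ε : ArithmeticFunction
  ε 1 = 1#
  ε _ = 0#

  ∗-product : ∀ {m} → Vector ArithmeticFunction m → ArithmeticFunction
  ∗-product = Vector.foldr _∗_ ε

  -- The sum of f over all tuples of m natural numbers that are at most b.
  sumTuples : ∀ m → ℕ → (Vector ℕ m → Carrier) → Carrier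
  sumTuples zero    b f = f []
  sumTuples (suc m) b f = ∑[ i ≤ b ] sumTuples m b λ a → f (toℕ i ∷ a)

  -- t j is the variable t_j for j ≥ 1; t 0 plays no role.
  fibonacciTerm : (n : ℕ) → (ℕ → Carrier) → Vector ℕ n → Carrier
  fibonacciTerm n t a with ℕ-Sum.sum (λ j → suc (toℕ j) ℕ.* a j) ℕ.≟ n
  ... | yes _ = multinomial a · product λ j → t (suc (toℕ j)) ^ a j
  ... | no _  = 0#

  -- The bound n on the exponents loses nothing: ∑ j a_j = n forces a_j ≤ n.
  fibonacci : ℕ → (ℕ → Carrier) → Carrier
  fibonacci n t = sumTuples n n (fibonacciTerm n t)

  module _ (p : ℕ) .{{_ : NonZero p}} where

    atPower : ArithmeticFunction → ℕ → Carrier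
    atPower α n = α (p ℕ.^ n) {{ℕ.m^n≢0 p n}}

    AgreeAt : ArithmeticFunction → ArithmeticFunction → Set ℓ
    AgreeAt α β = ∀ n → atPower α n ≈ atPower β n

    InverseAt : ArithmeticFunction → ArithmeticFunction → Set ℓ
    InverseAt α β = AgreeAt (α ∗ β) ε

    NonTrivialAt : ArithmeticFunction → Set ℓ
    NonTrivialAt α = ¬ AgreeAt α ε

    ParametersAt : ArithmeticFunction → (ℕ → Carrier) → Set ℓ
    ParametersAt α t = ∀ n → fibonacci n t ≈ atPower α n

    record DegreeAt (k : ℕ) (α : ArithmeticFunction) : Set (c ⊔ ℓ) where
      field
        1≤k          : 1 ≤ k
        parameter    : ℕ → Carrier
        isParameter  : ParametersAt α parameter
        leading      : ¬ (parameter k ≈ 0#)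
        vanishing    : ∀ j → k ℕ.< j → parameter j ≈ 0#

    record PositiveAt (m : ℕ) (α : ArithmeticFunction) : Set (c ⊔ ℓ) where
      field
        degree         : DegreeAt m α
        factor         : Vector ArithmeticFunction m
        multiplicative : ∀ i → IsMultiplicative (factor i)
        degree1        : ∀ i → DegreeAt 1 (factor i)
        factorisation  : AgreeAt α (∗-product factor)

    -- φ lists the factors as they occur in the product, that is, both the
    -- degree-1 functions and the inverses of degree-1 functions.
    NormalFormAt : ∀ {m} → Vector ArithmeticFunction m → Set ℓ
    NormalFormAt φ = ∀ i j → i ≢ j → ¬ InverseAt (φ i) (φ j)

open CommutativeRing ℂ-commutativeRing public using (_≈_; _*_; -_; 1#)
open Sums ℂ-commutativeRing public using (sum⁺-syntax; _^_)
open ArithmeticFunctions ℂ-commutativeRing public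

{-# OPTIONS --safe #-}
module Submission where

-- On powers of p everything is a power series: a degree-1 function is 1 / (1 − bx), and
-- a function with parameters s is 1 / (1 − s₁x − s₂x² − …), because the multinomial
-- Pascal rule gives F_{n+1} = ∑ t_{i+1} F_{n−i}. Hence γ is the series 1 − s₁x − s₂x² − …
-- itself, that is γ(p^j) = − s_j, and multiplying by 1 / (1 − bx) gives both formulas.

open import Algebra.Bundles using (CommutativeMonoid; CommutativeRing)
open import Data.Fin.Base as Fin using (Fin; zero; suc; toℕ; fromℕ; fromℕ<; inject₁; opposite)
import Data.Fin.Permutation as Permutation
import Data.Fin.Properties as Fin
open import Data.Nat.Base as ℕ using (ℕ; zero; suc; NonZero; _≤_; _<_; _∸_; z≤n; s≤s; _!)
open import Data.Nat.Combinatorics using (k![n∸k]!∣n!)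
open import Data.Nat.Divisibility
  using (_∣_; divides; _∣?_; ∣-refl; ∣-trans; *-monoʳ-∣; ∣1⇒≡1; m∣m*n; quotient; quotient≢0)
open import Data.Nat.DivMod using (m/n*n≡m)
open import Data.Nat.Induction using (<-rec)
open import Data.Nat.Primality using (Prime; euclidsLemma; prime⇒nonTrivial)
import Data.Nat.Properties as ℕ
open import Data.Product.Base using (_×_; _,_; ∃; proj₁; proj₂)
open import Data.Sum.Base using (inj₁; inj₂)
open import Data.Vec.Functional using (Vector; _∷_; []; head; tail; init; last; updateAt; removeAt)
open import Data.Vec.Functional.Properties using (updateAt-updates; updateAt-minimal)
open import Function.Base using (_∘_)
open import Relation.Binary.PropositionalEquality as ≡ using (_≡_; _≢_; _≗_; cong; cong₂; subst)
open import Relation.Nullary using (¬_; Dec; yes; no; contradiction)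

open import Defs
  using (multinomial; ∏!≢0; module ℕ-Sum; module ℕ-Product; module Sums; module ArithmeticFunctions)

-- Finite sums in a commutative monoid.

module SumLemmas {c ℓ} (M : CommutativeMonoid c ℓ) where
  open CommutativeMonoid M
  open import Algebra.Properties.CommutativeMonoid.Sum M
  open import Relation.Binary.Reasoning.Setoid setoid

  sum-zero : ∀ {n} (f : Vector Carrier n) → (∀ i → f i ≈ ε) → sum f ≈ ε
  sum-zero {n} f f≈ε = trans (sum-cong-≋ f≈ε) (sum-replicate-zero n)

  -- Pull out entry `i` on both sides; what is left agrees entrywise. In the additive and
  -- multiplicative monoids this gives the effect of raising one exponent on degree, weight,
  -- factorials and monomials.
  sum-update : ∀ {n} (f g : Vector Carrier n) i x → f i ≈ x ∙ g i →
               (∀ j → j ≢ i → f j ≈ g j) → sum f ≈ x ∙ sum g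
  sum-update {suc n} f g i x fi≈ fj≈ = begin
    sum f                              ≈⟨ sum-remove f ⟩
    f i ∙ sum (removeAt f i)           ≈⟨ ∙-cong fi≈ (sum-cong-≋ λ j → fj≈ _ (Fin.punchInᵢ≢i i j)) ⟩
    (x ∙ g i) ∙ sum (removeAt g i)     ≈⟨ assoc x _ _ ⟩
    x ∙ (g i ∙ sum (removeAt g i))     ≈⟨ ∙-congˡ (sum-remove g) ⟨
    x ∙ sum g                          ∎

  sum-single : ∀ {n} (f : Vector Carrier n) i → (∀ j → j ≢ i → f j ≈ ε) → sum f ≈ f i
  sum-single {n} f i fj≈ε = begin
    sum f                        ≈⟨ sum-update f (λ _ → ε) i (f i) (sym (identityʳ (f i))) fj≈ε ⟩
    f i ∙ sum {n} (λ _ → ε)      ≈⟨ ∙-congˡ (sum-replicate-zero n) ⟩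
    f i ∙ ε                      ≈⟨ identityʳ (f i) ⟩
    f i                          ∎

  sum-truncate : ∀ {m n} → m ≤ n → (f : ℕ → Carrier) → (∀ i → m ≤ i → f i ≈ ε) →
                 ∑[ i < n ] f (toℕ i) ≈ ∑[ i < m ] f (toℕ i)
  sum-truncate {n = n} z≤n f f≈ε = sum-zero {n} _ λ i → f≈ε (toℕ i) z≤n
  sum-truncate (s≤s m≤n)   f f≈ε =
    ∙-congˡ (sum-truncate m≤n (f ∘ suc) λ i m≤i → f≈ε (suc i) (s≤s m≤i))

  sum-init : ∀ {n} (f : Vector Carrier (suc n)) (g : Vector Carrier n) →
             (∀ i → init f i ≈ g i) → last f ≈ ε → sum f ≈ sum g
  sum-init f g init≈ last≈ε = begin
    sum f                 ≈⟨ sum-init-last f ⟩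
    sum (init f) ∙ last f ≈⟨ ∙-cong (sum-cong-≋ init≈) last≈ε ⟩
    sum g ∙ ε             ≈⟨ identityʳ (sum g) ⟩
    sum g                 ∎

  -- Reversal permutes the indices 0, ..., n, and `n ∸ (n ∸ i)` is `i` within that range.
  sum-reverse : ∀ n (f : ℕ → ℕ → Carrier) →
                ∑[ i ≤ n ] f (toℕ i) (n ∸ toℕ i) ≈ ∑[ i ≤ n ] f (n ∸ toℕ i) (toℕ i)
  sum-reverse n f = begin
    ∑[ i ≤ n ] f (toℕ i) (n ∸ toℕ i)
      ≈⟨ sum-permute {suc n} (λ i → f (toℕ i) (n ∸ toℕ i)) Permutation.reverse ⟩
    ∑[ i ≤ n ] f (toℕ (opposite i)) (n ∸ toℕ (opposite i))
      ≡⟨ sum-cong-≗ {suc n} (λ i → cong (λ j → f j (n ∸ j)) (Fin.opposite-prop i)) ⟩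
    ∑[ i ≤ n ] f (n ∸ toℕ i) (n ∸ (n ∸ toℕ i))
      ≡⟨ sum-cong-≗ {suc n} (λ i → cong (f (n ∸ toℕ i)) (ℕ.m∸[m∸n]≡n (Fin.toℕ≤pred[n] i))) ⟩
    ∑[ i ≤ n ] f (n ∸ toℕ i) (toℕ i) ∎

open SumLemmas using (sum-update; sum-init)

-- Exponent tuples: weights, multinomial coefficients and the Pascal rule.

-- A pointwise relation rather than an equation between tuples: tuples are functions, and no
-- extensionality is assumed.
Increment : ∀ {m} → Fin m → Vector ℕ m → Vector ℕ m → Set
Increment i a′ a = a i ≡ suc (a′ i) × (∀ j → j ≢ i → a j ≡ a′ j)

increment-decrement : ∀ {m} (a : Vector ℕ m) i {x} → a i ≡ suc x →
                      Increment i (updateAt a i ℕ.pred) a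
increment-decrement a i ai≡ =
  ≡.trans ai≡ (cong suc (≡.sym (≡.trans (updateAt-updates i a) (cong ℕ.pred ai≡)))) ,
  λ j j≢i → ≡.sym (updateAt-minimal j i a j≢i)

∏! : ∀ {m} → Vector ℕ m → ℕ
∏! a = ℕ-Product.sum λ j → a j !

weight : ∀ {m} → Vector ℕ m → ℕ
weight a = ℕ-Sum.sum λ j → suc (toℕ j) ℕ.* a j

module _ {m} {i : Fin m} {a′ a : Vector ℕ m} (inc : Increment i a′ a) where

  sum-increment : ℕ-Sum.sum a ≡ suc (ℕ-Sum.sum a′)
  sum-increment = sum-update ℕ.+-0-commutativeMonoid a a′ i 1 (proj₁ inc) (proj₂ inc)

  ∏!-increment : ∏! a ≡ suc (a′ i) ℕ.* ∏! a′
  ∏!-increment = sum-update ℕ.*-1-commutativeMonoid (λ j → a j !) (λ j → a′ j !) i (suc (a′ i))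
    (cong _! (proj₁ inc)) λ j j≢i → cong _! (proj₂ inc j j≢i)

  weight-increment : weight a ≡ suc (toℕ i) ℕ.+ weight a′
  weight-increment = sum-update ℕ.+-0-commutativeMonoid _ _ i (suc (toℕ i))
    (≡.trans (cong (suc (toℕ i) ℕ.*_) (proj₁ inc)) (ℕ.*-suc (suc (toℕ i)) (a′ i)))
    λ j j≢i → cong (suc (toℕ j) ℕ.*_) (proj₂ inc j j≢i)

≤-ℕ-sum : ∀ {m} (f : Vector ℕ m) i → f i ≤ ℕ-Sum.sum f
≤-ℕ-sum f zero    = ℕ.m≤m+n _ _
≤-ℕ-sum f (suc i) = ℕ.≤-trans (≤-ℕ-sum (tail f) i) (ℕ.m≤n+m _ _)

≤-weight : ∀ {m} (a : Vector ℕ m) i → a i ≤ weight a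
≤-weight a i = ℕ.≤-trans (ℕ.m≤m+n (a i) _) (≤-ℕ-sum (λ j → suc (toℕ j) ℕ.* a j) i)

-- The last variable alone contributes at least m + 1 to the weight. Hence it cannot occur in a
-- monomial of weight at most m.
last≢0⇒<weight : ∀ {m} (a : Vector ℕ (suc m)) → last a ≢ 0 → m < weight a
last≢0⇒<weight {m} a last≢0 = begin-strict
  m                              <⟨ ℕ.n<1+n m ⟩
  suc m                          ≡⟨ cong suc (Fin.toℕ-fromℕ m) ⟨
  suc (toℕ (fromℕ m))            ≤⟨ ℕ.m≤m*n (suc (toℕ (fromℕ m))) (last a) {{ℕ.≢-nonZero last≢0}} ⟩
  suc (toℕ (fromℕ m)) ℕ.* last a ≤⟨ ≤-ℕ-sum (λ j → suc (toℕ j) ℕ.* a j) (fromℕ m) ⟩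
  weight a                       ∎
  where open ℕ.≤-Reasoning

weight>0⇒sum>0 : ∀ {m} (a : Vector ℕ m) → 0 < weight a → 0 < ℕ-Sum.sum a
weight>0⇒sum>0 a w>0 = ℕ.n≢0⇒n>0 λ sum≡0 → ℕ.<⇒≢ w>0 (≡.sym (
  SumLemmas.sum-zero ℕ.+-0-commutativeMonoid (λ j → suc (toℕ j) ℕ.* a j) λ j →
    ≡.trans (cong (suc (toℕ j) ℕ.*_) (ℕ.n≤0⇒n≡0 (ℕ.≤-trans (≤-ℕ-sum a j) (ℕ.≤-reflexive sum≡0))))
      (ℕ.*-zeroʳ (suc (toℕ j)))))

∏!∣sum! : ∀ {m} (a : Vector ℕ m) → ∏! a ∣ ℕ-Sum.sum a !
∏!∣sum! {zero}  a = ∣-refl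
∏!∣sum! {suc m} a = ∣-trans (*-monoʳ-∣ (head a !) (∏!∣sum! (tail a)))
  -- The binomial case: for n = k + r, the product k! r! divides n!, with k the head and r the sum
  -- of the tail.
  (subst (λ x → head a ! ℕ.* x ! ∣ ℕ-Sum.sum a !) (ℕ.m+n∸m≡n (head a) (ℕ-Sum.sum (tail a)))
    (k![n∸k]!∣n! (ℕ.m≤m+n (head a) (ℕ-Sum.sum (tail a)))))

multinomial*∏! : ∀ {m} (a : Vector ℕ m) → multinomial a ℕ.* ∏! a ≡ ℕ-Sum.sum a !
multinomial*∏! a = m/n*n≡m {{∏!≢0 a}} (∏!∣sum! a)

-- Multiplying by the nonzero product of factorials replaces the quotients by factorials of the
-- sums. The tuples may differ in length, as is needed when a trailing zero is dropped.
multinomial-cong : ∀ {m n} (a : Vector ℕ m) (b : Vector ℕ n) →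
                   ℕ-Sum.sum a ≡ ℕ-Sum.sum b → ∏! a ≡ ∏! b → multinomial a ≡ multinomial b
multinomial-cong a b sum≡ ∏!≡ = ℕ.*-cancelʳ-≡ _ _ (∏! b) {{∏!≢0 b}} (begin
  multinomial a ℕ.* ∏! b ≡⟨ cong (multinomial a ℕ.*_) ∏!≡ ⟨
  multinomial a ℕ.* ∏! a ≡⟨ multinomial*∏! a ⟩
  ℕ-Sum.sum a !          ≡⟨ cong _! sum≡ ⟩
  ℕ-Sum.sum b !          ≡⟨ multinomial*∏! b ⟨
  multinomial b ℕ.* ∏! b ∎)
  where open ≡.≡-Reasoning

module _ {m} {a : Vector ℕ (suc m)} {a′ : Vector ℕ m} (init≗ : init a ≗ a′) (last≡0 : last a ≡ 0) where

  weight-init : weight a ≡ weight a′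
  weight-init = sum-init ℕ.+-0-commutativeMonoid (λ j → suc (toℕ j) ℕ.* a j) (λ j → suc (toℕ j) ℕ.* a′ j)
    (λ i → cong₂ (λ j x → suc j ℕ.* x) (Fin.toℕ-inject₁ i) (init≗ i))
    (≡.trans (cong (suc (toℕ (fromℕ m)) ℕ.*_) last≡0) (ℕ.*-zeroʳ (suc (toℕ (fromℕ m)))))

  multinomial-init : multinomial a ≡ multinomial a′
  multinomial-init = multinomial-cong a a′
    (sum-init ℕ.+-0-commutativeMonoid a a′ init≗ last≡0)
    (sum-init ℕ.*-1-commutativeMonoid (λ j → a j !) (λ j → a′ j !) (λ i → cong _! (init≗ i)) (cong _! last≡0))

-- The number of arrangements of the multiset a that start with the letter i.
share : ∀ {m} → Vector ℕ m → Fin m → ℕ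
share a i with a i
... | zero  = 0
... | suc _ = multinomial (updateAt a i ℕ.pred)

share-zero : ∀ {m} (a : Vector ℕ m) i → a i ≡ 0 → share a i ≡ 0
share-zero a i ai≡0 rewrite ai≡0 = ≡.refl

share-increment : ∀ {m} {i : Fin m} {a′ a} → Increment i a′ a → share a i ≡ multinomial a′
share-increment {i = i} {a′} {a} (ai≡ , aj≡) rewrite ai≡ =
  multinomial-cong (updateAt a i ℕ.pred) a′
    (ℕ-Sum.sum-cong-≗ pointwise)
    (ℕ-Product.sum-cong-≗ (cong _! ∘ pointwise))
  where
  pointwise : updateAt a i ℕ.pred ≗ a′
  pointwise j with j Fin.≟ i
  ... | yes ≡.refl = ≡.trans (updateAt-updates i a) (cong ℕ.pred ai≡)
  ... | no j≢i     = ≡.trans (updateAt-minimal j i a j≢i) (aj≡ j j≢i)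

-- If a_i > 0, removing one letter i takes the factor a_i out of the product of factorials, and the
-- remaining multinomial absorbs the rest. If a_i = 0, both sides vanish.
share*∏! : ∀ {m} (a : Vector ℕ m) i → share a i ℕ.* ∏! a ≡ a i ℕ.* ℕ.pred (ℕ-Sum.sum a) !
-- The exponent travels with an equation, so that the case split leaves `a i` itself in the goal.
share*∏! a i = go (a i) ≡.refl
  where
  open ≡.≡-Reasoning
  a⁻ = updateAt a i ℕ.pred
  go : ∀ x → a i ≡ x → share a i ℕ.* ∏! a ≡ a i ℕ.* ℕ.pred (ℕ-Sum.sum a) !
  go zero    ai≡ = ≡.trans (cong (ℕ._* ∏! a) (share-zero a i ai≡))
    (≡.sym (cong (ℕ._* ℕ.pred (ℕ-Sum.sum a) !) ai≡))
  go (suc x) ai≡ = begin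
    share a i ℕ.* ∏! a
      ≡⟨ cong₂ ℕ._*_ (share-increment inc) (∏!-increment inc) ⟩
    multinomial a⁻ ℕ.* (suc (a⁻ i) ℕ.* ∏! a⁻)
      ≡⟨ x∙yz≈y∙xz (multinomial a⁻) (suc (a⁻ i)) (∏! a⁻) ⟩
    suc (a⁻ i) ℕ.* (multinomial a⁻ ℕ.* ∏! a⁻)
      ≡⟨ cong₂ ℕ._*_ (≡.sym (proj₁ inc)) (multinomial*∏! a⁻) ⟩
    a i ℕ.* ℕ-Sum.sum a⁻ !
      ≡⟨ cong (λ r → a i ℕ.* ℕ.pred r !) (sum-increment inc) ⟨
    a i ℕ.* ℕ.pred (ℕ-Sum.sum a) ! ∎
    where
    inc = increment-decrement a i ai≡
    open import Algebra.Properties.CommutativeSemigroup ℕ.*-commutativeSemigroup using (x∙yz≈y∙xz)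

-- Every arrangement of a nonempty multiset has a first letter. After clearing denominators, with N
-- the sum of the a_i, this is N! = ∑ a_i (N - 1)!.
multinomial-pascal : ∀ {m} (a : Vector ℕ m) → 0 < ℕ-Sum.sum a →
                     multinomial a ≡ ℕ-Sum.sum (share a)
multinomial-pascal a sum>0 = ℕ.*-cancelʳ-≡ _ _ (∏! a) {{∏!≢0 a}} (begin
  multinomial a ℕ.* ∏! a                                    ≡⟨ multinomial*∏! a ⟩
  ℕ-Sum.sum a !                                             ≡⟨ unfold-! sum>0 ⟩
  ℕ-Sum.sum a ℕ.* r !                                       ≡⟨ *-distribʳ-sum (r !) a ⟩
  ℕ-Sum.sum (λ i → a i ℕ.* r !)                             ≡⟨ ℕ-Sum.sum-cong-≗ (share*∏! a) ⟨
  ℕ-Sum.sum (λ i → share a i ℕ.* ∏! a)                      ≡⟨ *-distribʳ-sum (∏! a) (share a) ⟨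
  ℕ-Sum.sum (share a) ℕ.* ∏! a                              ∎)
  where
  open ≡.≡-Reasoning
  open import Algebra.Properties.Semiring.Sum ℕ.+-*-semiring using (*-distribʳ-sum)
  r = ℕ.pred (ℕ-Sum.sum a)
  unfold-! : ∀ {n} → 0 < n → n ! ≡ n ℕ.* ℕ.pred n !
  unfold-! {suc n} _ = ≡.refl

-- Indicators of decidable conditions.

module Indicator {c ℓ} (R : CommutativeRing c ℓ) where
  open CommutativeRing R

  infix 10 [_]_

  -- A restricted sum becomes a full sum of indicator terms, so that double sums can be interchanged
  -- without changing their ranges.
  [_]_ : ∀ {P : Set} → Dec P → Carrier → Carrier
  [ yes _ ] x = x
  [ no _ ]  x = 0#

  []-true : ∀ {P : Set} (P? : Dec P) {x} → P → [ P? ] x ≈ x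
  []-true (yes _) p = refl
  []-true (no ¬p) p = contradiction p ¬p

  []-false : ∀ {P : Set} (P? : Dec P) {x} → ¬ P → [ P? ] x ≈ 0#
  []-false (yes p) ¬p = contradiction p ¬p
  []-false (no _)  ¬p = refl

  []-congʳ : ∀ {P : Set} (P? : Dec P) {x y} → x ≈ y → [ P? ] x ≈ [ P? ] y
  []-congʳ (yes _) x≈y = x≈y
  []-congʳ (no _)  x≈y = refl

  []-zero : ∀ {P : Set} (P? : Dec P) {x} → x ≈ 0# → [ P? ] x ≈ 0#
  []-zero (yes _) x≈0 = x≈0
  []-zero (no _)  x≈0 = refl

-- The linear recurrence of the generalized Fibonacci polynomials.

module FibonacciPolynomials {c ℓ} (R : CommutativeRing c ℓ) where
  open CommutativeRing R hiding (zero)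
  open Sums R using (_^_; _·_; product)
  open ArithmeticFunctions R using (sumTuples; fibonacciTerm; fibonacci)
  open SumLemmas +-commutativeMonoid
  open SumLemmas *-commutativeMonoid using () renaming (sum-update to product-update; sum-init to product-init)
  open Indicator R
  open import Algebra.Properties.Semiring.Sum semiring
  open import Algebra.Properties.Semiring.Mult semiring using (×-homo-+; ×-comm-*; ×-homo-1; ×-congʳ)
  open import Algebra.Properties.Semiring.Exp semiring using (^-congʳ)
  open import Relation.Binary.Reasoning.Setoid setoid

  sumTuples-cong : ∀ m b {f g : Vector ℕ m → Carrier} → (∀ a → f a ≈ g a) →
                   sumTuples m b f ≈ sumTuples m b g
  sumTuples-cong zero    b f≈g = f≈g []
  sumTuples-cong (suc m) b f≈g =
    sum-cong-≋ {suc b} λ x → sumTuples-cong m b λ a → f≈g (toℕ x ∷ a)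

  sumTuples-zero : ∀ m b {f : Vector ℕ m → Carrier} → (∀ a → f a ≈ 0#) → sumTuples m b f ≈ 0#
  sumTuples-zero zero    b f≈0 = f≈0 []
  sumTuples-zero (suc m) b f≈0 =
    sum-zero {suc b} _ λ x → sumTuples-zero m b λ a → f≈0 (toℕ x ∷ a)

  sumTuples-∑ : ∀ m b {n} (f : Fin n → Vector ℕ m → Carrier) →
                sumTuples m b (λ a → ∑[ i < n ] f i a) ≈ ∑[ i < n ] sumTuples m b (f i)
  sumTuples-∑ zero    b {n} f = refl
  sumTuples-∑ (suc m) b {n} f = trans
    (sum-cong-≋ {suc b} λ x → sumTuples-∑ m b λ i a → f i (toℕ x ∷ a))
    (∑-comm {suc b} {n} λ x i → sumTuples m b λ a → f i (toℕ x ∷ a))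

  sumTuples-*ˡ : ∀ m b x (f : Vector ℕ m → Carrier) →
                 sumTuples m b (λ a → x * f a) ≈ x * sumTuples m b f
  sumTuples-*ˡ zero    b x f = refl
  sumTuples-*ˡ (suc m) b x f = trans
    (sum-cong-≋ {suc b} λ y → sumTuples-*ˡ m b x λ a → f (toℕ y ∷ a))
    (sym (*-distribˡ-sum {suc b} x λ y → sumTuples m b λ a → f (toℕ y ∷ a)))

  sumTuples-truncate : ∀ m {w b} → w ≤ b → (f : Vector ℕ m → Carrier) →
                       (∀ a i → w < a i → f a ≈ 0#) → sumTuples m b f ≈ sumTuples m w f
  sumTuples-truncate zero    w≤b f f≈0 = refl
  sumTuples-truncate (suc m) {w} {b} w≤b f f≈0 = trans
    (sum-cong-≋ {suc b} λ x →
      sumTuples-truncate m w≤b (λ a → f (toℕ x ∷ a)) λ a i → f≈0 (toℕ x ∷ a) (suc i))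
    (sum-truncate (s≤s w≤b) (λ x → sumTuples m w λ a → f (x ∷ a)) λ x w<x →
      sumTuples-zero m w λ a → f≈0 (x ∷ a) zero w<x)

  -- Only tuples ending in 0 contribute, and these correspond to tuples with one entry fewer. The
  -- correspondence is stated pointwise, through `init a ≗ a′`.
  sumTuples-init : ∀ m b (f : Vector ℕ (suc m) → Carrier) (g : Vector ℕ m → Carrier) →
                   (∀ a → last a ≢ 0 → f a ≈ 0#) →
                   (∀ a a′ → init a ≗ a′ → last a ≡ 0 → f a ≈ g a′) →
                   sumTuples (suc m) b f ≈ sumTuples m b g
  sumTuples-init zero b f g f≈0 f≈g = trans
    (sum-single {suc b} (λ x → f (toℕ x ∷ [])) zero λ x x≢0 →
      f≈0 (toℕ x ∷ []) (x≢0 ∘ Fin.toℕ-injective))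
    (f≈g (0 ∷ []) [] (λ ()) ≡.refl)
  sumTuples-init (suc m) b f g f≈0 f≈g = sum-cong-≋ {suc b} λ x →
    sumTuples-init m b (λ a → f (toℕ x ∷ a)) (λ a → g (toℕ x ∷ a))
      (λ a → f≈0 (toℕ x ∷ a))
      λ a a′ eq → f≈g (toℕ x ∷ a) (toℕ x ∷ a′) λ { zero → ≡.refl ; (suc i) → eq i }

  -- Reindexing x + 1 to x in coordinate `i`. The range stays 0, ..., b because both terms that
  -- would spoil this vanish: `f` at the bottom, `g` at the top.
  sumTuples-shift : ∀ m b (i : Fin m) (f g : Vector ℕ m → Carrier) →
                    (∀ a → a i ≡ 0 → f a ≈ 0#) →
                    (∀ a′ a → Increment i a′ a → f a ≈ g a′) →
                    (∀ a → a i ≡ b → g a ≈ 0#) →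
                    sumTuples m b f ≈ sumTuples m b g
  sumTuples-shift (suc m) b zero f g f≈0 f≈g g≈0 = begin
    S f 0 + ∑[ x < b ] S f (suc (toℕ x))
      ≈⟨ +-cong (sumTuples-zero m b λ a → f≈0 (0 ∷ a) ≡.refl)
           (sum-cong-≋ {b} λ x → sumTuples-cong m b λ a →
             f≈g (toℕ x ∷ a) (suc (toℕ x) ∷ a)
               (≡.refl , λ { zero 0≢0 → contradiction ≡.refl 0≢0 ; (suc j) _ → ≡.refl })) ⟩
    0# + ∑[ x < b ] S g (toℕ x)
      ≈⟨ +-comm _ _ ⟩
    -- The 0 left by the bottom term of `f` is traded for the vanishing top term of `g`, which
    -- completes the range to x ≤ b.
    ∑[ x < b ] S g (toℕ x) + 0#
      ≈⟨ +-cong (reflexive (sum-cong-≗ {b} λ x → cong (S g) (≡.sym (Fin.toℕ-inject₁ x))))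
           (sym (sumTuples-zero m b λ a → g≈0 (toℕ (fromℕ b) ∷ a) (Fin.toℕ-fromℕ b))) ⟩
    ∑[ x < b ] S g (toℕ (inject₁ x)) + S g (toℕ (fromℕ b))
      ≈⟨ sum-init-last {b} (λ x → S g (toℕ x)) ⟨
    ∑[ x ≤ b ] S g (toℕ x) ∎
    where
    S : (Vector ℕ (suc m) → Carrier) → ℕ → Carrier
    S h x = sumTuples m b λ a → h (x ∷ a)
  sumTuples-shift (suc m) b (suc i) f g f≈0 f≈g g≈0 = sum-cong-≋ {suc b} λ x →
    sumTuples-shift m b i (λ a → f (toℕ x ∷ a)) (λ a → g (toℕ x ∷ a))
      (λ a → f≈0 (toℕ x ∷ a))
      (λ a′ a (ai≡ , aj≡) → f≈g (toℕ x ∷ a′) (toℕ x ∷ a)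
        (ai≡ , λ { zero _ → ≡.refl ; (suc j) j≢i → aj≡ j (j≢i ∘ cong suc) }))
      λ a → g≈0 (toℕ x ∷ a)

  ·-sum : ∀ {n} (f : Vector ℕ n) x → ℕ-Sum.sum f · x ≈ ∑[ i < n ] (f i · x)
  ·-sum {zero}  f x = refl
  ·-sum {suc n} f x = trans (×-homo-+ x (head f) (ℕ-Sum.sum (tail f))) (+-congˡ (·-sum (tail f) x))

  module _ (t : ℕ → Carrier) where

    monomial : ∀ {m} → Vector ℕ m → Carrier
    monomial a = product λ j → t (suc (toℕ j)) ^ a j

    monomial-increment : ∀ {m} {i : Fin m} {a′ a} → Increment i a′ a →
                         monomial a ≈ t (suc (toℕ i)) * monomial a′
    monomial-increment {i = i} (ai≡ , aj≡) = product-update _ _ i (t (suc (toℕ i)))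
      (^-congʳ (t (suc (toℕ i))) ai≡) λ j j≢i → ^-congʳ (t (suc (toℕ j))) (aj≡ j j≢i)

    -- `fibonacciTerm` with the number of variables freed from the weight: the recurrence compares
    -- polynomials of different weights in the same variables.
    weightedTerm : ∀ {m} → ℕ → Vector ℕ m → Carrier
    weightedTerm w a = [ weight a ℕ.≟ w ] (multinomial a · monomial a)

    fibonacciTerm≈weightedTerm : ∀ n a → fibonacciTerm n t a ≈ weightedTerm n a
    fibonacciTerm≈weightedTerm n a with weight a ℕ.≟ n
    ... | yes _ = refl
    ... | no _  = refl

    weightedTerm-zero : ∀ {m} {w} {a : Vector ℕ m} → w < weight a → weightedTerm w a ≈ 0#
    weightedTerm-zero {a = a} w<weight = []-false (weight a ℕ.≟ _) (ℕ.>⇒≢ w<weight)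

    weightedTerm-init : ∀ {m} w (a : Vector ℕ (suc m)) (a′ : Vector ℕ m) →
                        init a ≗ a′ → last a ≡ 0 → weightedTerm w a ≈ weightedTerm w a′
    weightedTerm-init {m} w a a′ init≗ last≡0
      rewrite weight-init {a = a} init≗ last≡0 | multinomial-init {a = a} init≗ last≡0 =
        []-congʳ (weight a′ ℕ.≟ w) (×-congʳ (multinomial a′) (product-init
          (λ j → t (suc (toℕ j)) ^ a j) (λ j → t (suc (toℕ j)) ^ a′ j)
          (λ i → reflexive (cong₂ (λ j x → t (suc j) ^ x) (Fin.toℕ-inject₁ i) (init≗ i)))
          (^-congʳ (t (suc (toℕ (fromℕ m)))) last≡0)))

    -- At weight w no exponent exceeds w and no variable beyond t_w occurs, so larger bounds and
    -- further variables add only zero terms.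
    sumTuples-weightedTerm : ∀ {m b w} → w ≤ m → w ≤ b →
                             sumTuples m b (weightedTerm w) ≈ fibonacci w t
    sumTuples-weightedTerm {m} {b} {w} w≤m w≤b = begin
      sumTuples m b (weightedTerm w)
        ≈⟨ sumTuples-truncate m w≤b (weightedTerm w) (λ a i w<ai →
             weightedTerm-zero {a = a} (ℕ.<-≤-trans w<ai (≤-weight a i))) ⟩
      sumTuples m w (weightedTerm w)
        ≈⟨ go (ℕ.≤⇒≤′ w≤m) ⟩
      sumTuples w w (weightedTerm w)
        ≈⟨ sumTuples-cong w w (fibonacciTerm≈weightedTerm w) ⟨
      fibonacci w t ∎
      where
      go : ∀ {m} → w ℕ.≤′ m → sumTuples m w (weightedTerm w) ≈ sumTuples w w (weightedTerm w)
      go ℕ.≤′-refl = refl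
      go (ℕ.≤′-step {m} w≤′m) = trans
        (sumTuples-init m w (weightedTerm w) (weightedTerm w)
          (λ a last≢0 → weightedTerm-zero {a = a} (ℕ.≤-<-trans (ℕ.≤′⇒≤ w≤′m) (last≢0⇒<weight a last≢0)))
          (weightedTerm-init w))
        (go w≤′m)

    -- The portion of a weighted term that counts arrangements with first letter `i`.
    shareTerm : ∀ {m} → ℕ → Fin m → Vector ℕ m → Carrier
    shareTerm w i a = [ weight a ℕ.≟ w ] (share a i · monomial a)

    weightedTerm-pascal : ∀ {m} n (a : Vector ℕ m) →
                          weightedTerm (suc n) a ≈ ∑[ i < m ] shareTerm (suc n) i a
    weightedTerm-pascal {m} n a with weight a ℕ.≟ suc n
    ... | yes w≡ = trans
      (reflexive (cong (_· monomial a)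
        -- Weight n + 1 is positive, so the multiset is nonempty and the Pascal rule applies.
        (multinomial-pascal a (weight>0⇒sum>0 a (subst (0 <_) (≡.sym w≡) ℕ.z<s)))))
      (·-sum (share a) (monomial a))
    ... | no _   = sym (sum-zero {m} _ λ _ → refl)

    shareTerm-zero : ∀ {m} w (i : Fin m) a → a i ≡ 0 → shareTerm w i a ≈ 0#
    shareTerm-zero w i a ai≡0 = []-zero (weight a ℕ.≟ w)
      (reflexive (cong (_· monomial a) (share-zero a i ai≡0)))

    -- Striking the first letter `i` removes one factor t_{i+1} and lowers the weight by i + 1,
    -- since coordinates count from 0.
    shareTerm-increment : ∀ {m n} (i : Fin m) → toℕ i ≤ n → ∀ a′ a → Increment i a′ a →
                          shareTerm (suc n) i a ≈ t (suc (toℕ i)) * weightedTerm (n ∸ toℕ i) a′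
    shareTerm-increment {n = n} i i≤n a′ a inc with weight a′ ℕ.≟ n ∸ toℕ i
    ... | yes w≡ = begin
      shareTerm (suc n) i a
        ≈⟨ []-true (weight a ℕ.≟ suc n) (≡.trans (weight-increment inc)
             (cong suc (≡.trans (cong (toℕ i ℕ.+_) w≡) (ℕ.m+[n∸m]≡n i≤n)))) ⟩
      share a i · monomial a
        ≈⟨ reflexive (cong (_· monomial a) (share-increment inc)) ⟩
      multinomial a′ · monomial a
        ≈⟨ ×-congʳ (multinomial a′) (monomial-increment inc) ⟩
      multinomial a′ · (t (suc (toℕ i)) * monomial a′)
        ≈⟨ ×-comm-* (multinomial a′) (t (suc (toℕ i))) (monomial a′) ⟨
      t (suc (toℕ i)) * (multinomial a′ · monomial a′) ∎
    ... | no w≢  = trans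
      ([]-false (weight a ℕ.≟ suc n) λ w≡ → w≢ (≡.trans (≡.sym (ℕ.m+n∸m≡n (toℕ i) (weight a′)))
        (cong (_∸ toℕ i) (ℕ.suc-injective (≡.trans (≡.sym (weight-increment inc)) w≡)))))
      (sym (zeroʳ _))

    fibonacci-zero : fibonacci 0 t ≈ 1#
    fibonacci-zero = ×-homo-1 1#

    -- Sort the arrangements of weight n + 1 by their first letter: those starting with `i`
    -- contribute t_{i+1} F_{n-i}.
    fibonacci-suc : ∀ n → fibonacci (suc n) t ≈ ∑[ i ≤ n ] (t (suc (toℕ i)) * fibonacci (n ∸ toℕ i) t)
    fibonacci-suc n = begin
      sumTuples N N (fibonacciTerm N t)
        ≈⟨ sumTuples-cong N N (λ a → trans (fibonacciTerm≈weightedTerm N a) (weightedTerm-pascal n a)) ⟩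
      sumTuples N N (λ a → ∑[ i ≤ n ] shareTerm N i a)
        ≈⟨ sumTuples-∑ N N (shareTerm N) ⟩
      ∑[ i ≤ n ] sumTuples N N (shareTerm N i)
        ≈⟨ sum-cong-≋ {N} column ⟩
      ∑[ i ≤ n ] (t (suc (toℕ i)) * fibonacci (n ∸ toℕ i) t) ∎
      where
      N = suc n

      n∸i<N : ∀ (i : Fin N) → n ∸ toℕ i < N
      n∸i<N i = s≤s (ℕ.m∸n≤m n (toℕ i))

      -- An exponent n + 1 forces weight at least n + 1, more than n - i; this is the vanishing top
      -- term that the shift requires.
      boundary : ∀ i (a : Vector ℕ N) → a i ≡ N → t (suc (toℕ i)) * weightedTerm (n ∸ toℕ i) a ≈ 0#
      boundary i a ai≡N = trans
        (*-congˡ (weightedTerm-zero {a = a}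
          (ℕ.<-≤-trans (n∸i<N i) (subst (_≤ weight a) ai≡N (≤-weight a i)))))
        (zeroʳ _)

      column : ∀ i → sumTuples N N (shareTerm N i) ≈ t (suc (toℕ i)) * fibonacci (n ∸ toℕ i) t
      column i = begin
        sumTuples N N (shareTerm N i)
          ≈⟨ sumTuples-shift N N i _ _ (shareTerm-zero N i)
               (shareTerm-increment i (Fin.toℕ≤pred[n] i)) (boundary i) ⟩
        sumTuples N N (λ a → t (suc (toℕ i)) * weightedTerm (n ∸ toℕ i) a)
          ≈⟨ sumTuples-*ˡ N N (t (suc (toℕ i))) (weightedTerm (n ∸ toℕ i)) ⟩
        t (suc (toℕ i)) * sumTuples N N (weightedTerm (n ∸ toℕ i))
          ≈⟨ *-congˡ (sumTuples-weightedTerm (ℕ.<⇒≤ (n∸i<N i)) (ℕ.<⇒≤ (n∸i<N i))) ⟩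
        t (suc (toℕ i)) * fibonacci (n ∸ toℕ i) t ∎

-- Divisors of prime powers.

m^k*m^[n∸k]≡m^n : ∀ m {k n} → k ≤ n → m ℕ.^ k ℕ.* m ℕ.^ (n ∸ k) ≡ m ℕ.^ n
m^k*m^[n∸k]≡m^n m {k} {n} k≤n =
  ≡.trans (≡.sym (ℕ.^-distribˡ-+-* m k (n ∸ k))) (cong (m ℕ.^_) (ℕ.m+[n∸m]≡n k≤n))

^-monoʳ-∣ : ∀ m {k n} → k ≤ n → m ℕ.^ k ∣ m ℕ.^ n
^-monoʳ-∣ m {k} {n} k≤n = subst (m ℕ.^ k ∣_) (m^k*m^[n∸k]≡m^n m k≤n) (m∣m*n (m ℕ.^ (n ∸ k)))

module PrimePowers {p : ℕ} .{{_ : NonZero p}} (p-prime : Prime p) where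

  1<p : 1 < p
  1<p = ℕ.nonTrivial⇒n>1 p {{prime⇒nonTrivial p-prime}}

  ^-injectiveʳ : ∀ {m n} → p ℕ.^ m ≡ p ℕ.^ n → m ≡ n
  ^-injectiveʳ {m} {n} eq = ℕ.≤-antisym
    (ℕ.≮⇒≥ λ n<m → ℕ.<⇒≢ (ℕ.^-monoʳ-< p 1<p n<m) (≡.sym eq))
    (ℕ.≮⇒≥ λ m<n → ℕ.<⇒≢ (ℕ.^-monoʳ-< p 1<p m<n) eq)

  -- In q d = p · p^n, Euclid's lemma puts a factor p into the cofactor or into d. Cancelling it
  -- leaves the case n; only in the second case does the exponent of d grow.
  ∣p^n⇒≡p^k : ∀ n {d} → d ∣ p ℕ.^ n → ∃ λ k → k ≤ n × d ≡ p ℕ.^ k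
  ∣p^n⇒≡p^k zero    d∣1 = 0 , z≤n , ∣1⇒≡1 d∣1
  ∣p^n⇒≡p^k (suc n) {d} (divides q eq) with euclidsLemma q d p-prime (subst (p ∣_) eq (m∣m*n (p ℕ.^ n)))
  ... | inj₁ (divides q′ ≡.refl) =
    let k , k≤n , d≡ = ∣p^n⇒≡p^k n (divides q′ (ℕ.*-cancelˡ-≡ _ _ p (≡.trans eq (regroup q′ p d))))
    in k , ℕ.m≤n⇒m≤1+n k≤n , d≡
    where
    regroup : ∀ x y z → x ℕ.* y ℕ.* z ≡ y ℕ.* (x ℕ.* z)
    regroup x y z = ≡.trans (cong (ℕ._* z) (ℕ.*-comm x y)) (ℕ.*-assoc y x z)
  ... | inj₂ (divides d′ ≡.refl) =
    let k , k≤n , d′≡ = ∣p^n⇒≡p^k n (divides q (ℕ.*-cancelˡ-≡ _ _ p (≡.trans eq (regroup q d′ p))))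
    in suc k , s≤s k≤n , ≡.trans (ℕ.*-comm d′ p) (cong (p ℕ.*_) d′≡)
    where
    regroup : ∀ x y z → x ℕ.* (y ℕ.* z) ≡ z ℕ.* (x ℕ.* y)
    regroup x y z = ≡.trans (≡.sym (ℕ.*-assoc x y z)) (ℕ.*-comm (x ℕ.* y) z)

-- Power series attached to sequences of values and parameters.

module LocalFunctions {c ℓ} (R : CommutativeRing c ℓ) where
  open CommutativeRing R hiding (zero)
  open Sums R using (_^_)
  open ArithmeticFunctions R
  open SumLemmas +-commutativeMonoid
  open Indicator R
  open FibonacciPolynomials R
  open import Algebra.Properties.Semiring.Sum semiring
  open import Algebra.Properties.Ring ring
    using (-0#≈0#; -‿+-comm; -‿distribˡ-*; -‿distribʳ-*; -‿involutive; +-cancelˡ)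
  open import Relation.Binary.Reasoning.Setoid setoid

  -‿sum : ∀ {n} (f : Vector Carrier n) → - sum f ≈ ∑[ i < n ] (- f i)
  -‿sum {zero}  f = -0#≈0#
  -‿sum {suc n} f = trans (sym (-‿+-comm _ _)) (+-congˡ (-‿sum (tail f)))

  -- A power series with constant term 1 can be cancelled. By strong induction the lower
  -- coefficients agree, and the last summands are exactly `u n` and `v n`.
  convolve-cancelʳ : ∀ (u v w : ℕ → Carrier) → w 0 ≈ 1# →
                     (∀ n → ∑[ j ≤ n ] (u (toℕ j) * w (n ∸ toℕ j)) ≈ ∑[ j ≤ n ] (v (toℕ j) * w (n ∸ toℕ j))) →
                     ∀ n → u n ≈ v n
  convolve-cancelʳ u v w w₀≈1 convolve≈ = <-rec (λ n → u n ≈ v n) step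
    where
    split-last : ∀ x n → ∑[ j ≤ n ] (x (toℕ j) * w (n ∸ toℕ j)) ≈
                         ∑[ j < n ] (x (toℕ j) * w (n ∸ toℕ j)) + x n
    split-last x n = begin
      ∑[ j ≤ n ] term (toℕ j)                                 ≈⟨ sum-init-last {n} (λ j → term (toℕ j)) ⟩
      ∑[ j < n ] term (toℕ (inject₁ j)) + term (toℕ (fromℕ n))
        ≡⟨ cong₂ _+_ (sum-cong-≗ {n} λ j → cong term (Fin.toℕ-inject₁ j)) (cong term (Fin.toℕ-fromℕ n)) ⟩
      ∑[ j < n ] term (toℕ j) + x n * w (n ∸ n)
        ≈⟨ +-congˡ (trans (*-congˡ (trans (reflexive (cong w (ℕ.n∸n≡0 n))) w₀≈1)) (*-identityʳ (x n))) ⟩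
      ∑[ j < n ] term (toℕ j) + x n                           ∎
      where
      term : ℕ → Carrier
      term j = x j * w (n ∸ j)
    step : ∀ n → (∀ {m} → m < n → u m ≈ v m) → u n ≈ v n
    step n below = +-cancelˡ (∑[ j < n ] (v (toℕ j) * w (n ∸ toℕ j))) (u n) (v n) (begin
      ∑[ j < n ] (v (toℕ j) * w (n ∸ toℕ j)) + u n ≈⟨ +-congʳ (sum-cong-≋ {n} λ j → *-congʳ (below (Fin.toℕ<n j))) ⟨
      ∑[ j < n ] (u (toℕ j) * w (n ∸ toℕ j)) + u n ≈⟨ split-last u n ⟨
      ∑[ j ≤ n ] (u (toℕ j) * w (n ∸ toℕ j))       ≈⟨ convolve≈ n ⟩
      ∑[ j ≤ n ] (v (toℕ j) * w (n ∸ toℕ j))       ≈⟨ split-last v n ⟩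
      ∑[ j < n ] (v (toℕ j) * w (n ∸ toℕ j)) + v n ∎)

  δ : ℕ → Carrier
  δ zero    = 1#
  δ (suc _) = 0#

  -- This is (1 - s₁x - s₂x² - ...) ∑ F_n xⁿ = 1 read off coefficientwise: s₀ = -1 makes the summand
  -- j = 0 equal to F_n, and the recurrence cancels it against the others.
  fibonacci-inverse : ∀ s → s 0 ≈ - 1# → ∀ n →
                      ∑[ j ≤ n ] (- s (toℕ j) * fibonacci (n ∸ toℕ j) s) ≈ δ n
  fibonacci-inverse s s₀≈-1 n = trans (+-congʳ -s₀*F≈F) (rest n)
    where
    -s₀*F≈F : - s 0 * fibonacci n s ≈ fibonacci n s
    -s₀*F≈F = trans (*-congʳ (trans (-‿cong s₀≈-1) (-‿involutive 1#))) (*-identityˡ _)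

    rest : ∀ n → fibonacci n s + ∑[ j < n ] (- s (suc (toℕ j)) * fibonacci (n ∸ suc (toℕ j)) s) ≈ δ n
    rest zero    = trans (+-identityʳ _) (fibonacci-zero s)
    rest (suc n) = begin
      fibonacci (suc n) s + ∑[ j ≤ n ] (- s (suc (toℕ j)) * fibonacci (n ∸ toℕ j) s)
        ≈⟨ +-cong (fibonacci-suc s n) (sum-cong-≋ {suc n} λ j →
             sym (-‿distribˡ-* (s (suc (toℕ j))) (fibonacci (n ∸ toℕ j) s))) ⟩
      ∑[ j ≤ n ] (s (suc (toℕ j)) * fibonacci (n ∸ toℕ j) s) +
      ∑[ j ≤ n ] (- (s (suc (toℕ j)) * fibonacci (n ∸ toℕ j) s))
        ≈⟨ +-congˡ (-‿sum {suc n} λ j → s (suc (toℕ j)) * fibonacci (n ∸ toℕ j) s) ⟨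
      ∑[ j ≤ n ] (s (suc (toℕ j)) * fibonacci (n ∸ toℕ j) s) -
      ∑[ j ≤ n ] (s (suc (toℕ j)) * fibonacci (n ∸ toℕ j) s)
        ≈⟨ -‿inverseʳ _ ⟩
      0# ∎

  fibonacci-degree1 : ∀ t → (∀ j → 1 < j → t j ≈ 0#) → ∀ n → fibonacci n t ≈ t 1 ^ n
  fibonacci-degree1 t t≈0 zero    = fibonacci-zero t
  fibonacci-degree1 t t≈0 (suc n) = begin
    fibonacci (suc n) t
      ≈⟨ fibonacci-suc t n ⟩
    ∑[ i ≤ n ] (t (suc (toℕ i)) * fibonacci (n ∸ toℕ i) t)
      ≈⟨ sum-single {suc n} (λ i → t (suc (toℕ i)) * fibonacci (n ∸ toℕ i) t) zero
           (λ { zero 0≢0 → contradiction ≡.refl 0≢0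
              ; (suc i) _ → trans (*-congʳ (t≈0 _ (s≤s ℕ.z<s))) (zeroˡ _) }) ⟩
    t 1 * fibonacci n t
      ≈⟨ *-congˡ (fibonacci-degree1 t t≈0 n) ⟩
    t 1 * t 1 ^ n ∎

  -- The `NonZero` proofs are irrelevant, so the values coincide whichever proofs accompany the
  -- arguments.
  application-cong : ∀ (α : ArithmeticFunction) {m n} .{{_ : NonZero m}} .{{_ : NonZero n}} →
                     m ≡ n → α m ≈ α n
  application-cong α ≡.refl = refl

  -- Dirichlet convolution on powers of a prime.

  module _ {p : ℕ} .{{_ : NonZero p}} (p-prime : Prime p) where
    open PrimePowers p-prime

    ε-atPower : ∀ n → atPower p ε n ≈ δ n
    ε-atPower zero    = refl
    ε-atPower (suc n) = ε-≢1 (p ℕ.^ suc n) {{ℕ.m^n≢0 p (suc n)}}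
      λ eq → ℕ.1+n≢0 (^-injectiveʳ {suc n} {0} eq)
      where
      ε-≢1 : ∀ m .{{_ : NonZero m}} → m ≢ 1 → ε m ≈ 0#
      ε-≢1 0             m≢1 = refl
      ε-≢1 1             m≢1 = contradiction ≡.refl m≢1
      ε-≢1 (suc (suc m)) m≢1 = refl

    -- A divisor of p^n is p^j for exactly one j ≤ n, and a non-divisor is no such power. The
    -- indicator form prepares the interchange of sums over d and j.
    convolutionTerm-atPower : ∀ α β n d .{{_ : NonZero d}} →
      convolutionTerm α β (p ℕ.^ n) {{ℕ.m^n≢0 p n}} d ≈
      ∑[ j ≤ n ] ([ d ℕ.≟ p ℕ.^ toℕ j ] (atPower p α (toℕ j) * atPower p β (n ∸ toℕ j)))
    convolutionTerm-atPower α β n d with d ∣? p ℕ.^ n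
    ... | no d∤p^n = sym (sum-zero {suc n}
      (λ j → [ d ℕ.≟ p ℕ.^ toℕ j ] (atPower p α (toℕ j) * atPower p β (n ∸ toℕ j)))
      λ j → []-false (d ℕ.≟ p ℕ.^ toℕ j) λ d≡ →
        d∤p^n (subst (_∣ p ℕ.^ n) (≡.sym d≡) (^-monoʳ-∣ p (Fin.toℕ≤pred[n] j))))
    ... | yes d∣p^n with ∣p^n⇒≡p^k n d∣p^n
    ... | k , k≤n , d≡p^k = sym (begin
      ∑[ j ≤ n ] ([ d ℕ.≟ p ℕ.^ toℕ j ] term j)
        ≈⟨ sum-single {suc n} (λ j → [ d ℕ.≟ p ℕ.^ toℕ j ] term j) i (λ j j≢i →
             []-false (d ℕ.≟ p ℕ.^ toℕ j) λ d≡p^j → j≢i (Fin.toℕ-injective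
               (^-injectiveʳ {toℕ j} {toℕ i} (≡.trans (≡.sym d≡p^j) d≡p^i)))) ⟩
      [ d ℕ.≟ p ℕ.^ toℕ i ] term i
        ≈⟨ []-true (d ℕ.≟ p ℕ.^ toℕ i) d≡p^i ⟩
      term i
        ≈⟨ *-cong
             (application-cong α {{ℕ.m^n≢0 p (toℕ i)}} (≡.sym d≡p^i))
             (application-cong β {{ℕ.m^n≢0 p (n ∸ toℕ i)}} {{q≢0}} (≡.sym q≡)) ⟩
      α d * β (quotient d∣p^n) {{q≢0}} ∎)
      where
      term : Fin (suc n) → Carrier
      term j = atPower p α (toℕ j) * atPower p β (n ∸ toℕ j)

      i : Fin (suc n)
      i = fromℕ< (s≤s k≤n)

      d≡p^i : d ≡ p ℕ.^ toℕ i
      d≡p^i = ≡.trans d≡p^k (cong (p ℕ.^_) (≡.sym (Fin.toℕ-fromℕ< (s≤s k≤n))))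

      q≢0 : NonZero (quotient d∣p^n)
      q≢0 = quotient≢0 d∣p^n {{ℕ.m^n≢0 p n}}

      q≡ : quotient d∣p^n ≡ p ℕ.^ (n ∸ toℕ i)
      q≡ = ℕ.*-cancelʳ-≡ _ _ d (≡.trans (≡.sym (_∣_.equality d∣p^n))
        (≡.trans (≡.sym (m^k*m^[n∸k]≡m^n p (Fin.toℕ≤pred[n] i)))
          (≡.trans (ℕ.*-comm (p ℕ.^ toℕ i) _) (cong (p ℕ.^ (n ∸ toℕ i) ℕ.*_) (≡.sym d≡p^i)))))

    -- Dirichlet convolution becomes the Cauchy product: after interchanging the sums, each exponent
    -- j selects the single divisor p^j.
    atPower-∗ : ∀ α β n → atPower p (α ∗ β) n ≈ ∑[ j ≤ n ] (atPower p α (toℕ j) * atPower p β (n ∸ toℕ j))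
    atPower-∗ α β n = begin
      ∑[ i < p ℕ.^ n ] convolutionTerm α β (p ℕ.^ n) {{ℕ.m^n≢0 p n}} (suc (toℕ i))
        ≈⟨ sum-cong-≋ {p ℕ.^ n} (λ i → convolutionTerm-atPower α β n (suc (toℕ i))) ⟩
      ∑[ i < p ℕ.^ n ] ∑[ j ≤ n ] ([ suc (toℕ i) ℕ.≟ p ℕ.^ toℕ j ] term j)
        ≈⟨ ∑-comm {p ℕ.^ n} {suc n} (λ i j → [ suc (toℕ i) ℕ.≟ p ℕ.^ toℕ j ] term j) ⟩
      ∑[ j ≤ n ] ∑[ i < p ℕ.^ n ] ([ suc (toℕ i) ℕ.≟ p ℕ.^ toℕ j ] term j)
        ≈⟨ sum-cong-≋ {suc n} (λ j → trans
             (sum-single (λ i → [ suc (toℕ i) ℕ.≟ p ℕ.^ toℕ j ] term j) (index j) λ i i≢ →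
               []-false (suc (toℕ i) ℕ.≟ p ℕ.^ toℕ j) λ eq → i≢ (Fin.toℕ-injective
                 (ℕ.suc-injective (≡.trans eq (≡.sym (suc-index j))))))
             ([]-true (suc (toℕ (index j)) ℕ.≟ p ℕ.^ toℕ j) (suc-index j))) ⟩
      ∑[ j ≤ n ] term j ∎
      where
      term : Fin (suc n) → Carrier
      term j = atPower p α (toℕ j) * atPower p β (n ∸ toℕ j)

      suc-pred : ∀ k → suc (ℕ.pred (p ℕ.^ k)) ≡ p ℕ.^ k
      suc-pred k = ℕ.suc-pred (p ℕ.^ k) {{ℕ.m^n≢0 p k}}

      pred<p^n : ∀ (j : Fin (suc n)) → ℕ.pred (p ℕ.^ toℕ j) < p ℕ.^ n
      pred<p^n j = subst (_≤ p ℕ.^ n) (≡.sym (suc-pred (toℕ j))) (ℕ.^-monoʳ-≤ p (Fin.toℕ≤pred[n] j))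

      -- Position i of the convolution sum stands for the divisor i + 1, so p^j sits at p^j - 1.
      index : Fin (suc n) → Fin (p ℕ.^ n)
      index j = fromℕ< (pred<p^n j)

      suc-index : ∀ j → suc (toℕ (index j)) ≡ p ℕ.^ toℕ j
      suc-index j = ≡.trans (cong suc (Fin.toℕ-fromℕ< (pred<p^n j))) (suc-pred (toℕ j))

    -- With only t₁ present the recurrence is geometric, and its case n = 1 identifies t₁ with β(p).
    atPower-degree1 : ∀ {β} → DegreeAt p 1 β → ∀ n → atPower p β n ≈ β p ^ n
    atPower-degree1 {β} degree n = begin
      atPower p β n   ≈⟨ isParameter n ⟨
      fibonacci n t   ≈⟨ fibonacci-degree1 t vanishing n ⟩
      t 1 ^ n         ≈⟨ ^-congˡ n t₁≈βp ⟩
      β p ^ n         ∎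
      where
      open DegreeAt degree renaming (parameter to t)
      open import Algebra.Properties.Semiring.Exp semiring using (^-congˡ)
      t₁≈βp : t 1 ≈ β p
      t₁≈βp = begin
        t 1             ≈⟨ *-identityʳ (t 1) ⟨
        t 1 * 1#        ≈⟨ fibonacci-degree1 t vanishing 1 ⟨
        fibonacci 1 t   ≈⟨ isParameter 1 ⟩
        atPower p β 1   ≈⟨ application-cong β {{ℕ.m^n≢0 p 1}} (ℕ.^-identityʳ p) ⟩
        β p             ∎

    -- Both sequences are inverse to the series ∑ F_n(s) xⁿ; its constant term 1 lets it be
    -- cancelled.
    atPower-inverse : ∀ {γ γ⁻¹} → InverseAt p γ γ⁻¹ →
                      ∀ s → s 0 ≈ - 1# → ParametersAt p γ⁻¹ s → ∀ n → atPower p γ n ≈ - s n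
    atPower-inverse {γ} {γ⁻¹} γ∗γ⁻¹≈ε s s₀≈-1 isParameter =
      convolve-cancelʳ (atPower p γ) (λ n → - s n) (λ n → fibonacci n s) (fibonacci-zero s) λ n → begin
        ∑[ j ≤ n ] (atPower p γ (toℕ j) * fibonacci (n ∸ toℕ j) s)
          ≈⟨ sum-cong-≋ {suc n} (λ j → *-congˡ {atPower p γ (toℕ j)} (isParameter (n ∸ toℕ j))) ⟩
        ∑[ j ≤ n ] (atPower p γ (toℕ j) * atPower p γ⁻¹ (n ∸ toℕ j))
          ≈⟨ atPower-∗ γ γ⁻¹ n ⟨
        atPower p (γ ∗ γ⁻¹) n
          ≈⟨ γ∗γ⁻¹≈ε n ⟩
        atPower p ε n
          ≈⟨ ε-atPower n ⟩
        δ n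
          ≈⟨ fibonacci-inverse s s₀≈-1 n ⟨
        ∑[ j ≤ n ] (- s (toℕ j) * fibonacci (n ∸ toℕ j) s) ∎

    atPower-degree1-∗ : ∀ {β} → DegreeAt p 1 β → ∀ γ n →
      atPower p (β ∗ γ) n ≈ ∑[ j ≤ n ] (β p ^ (n ∸ toℕ j) * atPower p γ (toℕ j))
    atPower-degree1-∗ {β} degree γ n = begin
      atPower p (β ∗ γ) n
        ≈⟨ atPower-∗ β γ n ⟩
      ∑[ j ≤ n ] (atPower p β (toℕ j) * atPower p γ (n ∸ toℕ j))
        ≈⟨ sum-reverse n (λ i j → atPower p β i * atPower p γ j) ⟩
      ∑[ j ≤ n ] (atPower p β (n ∸ toℕ j) * atPower p γ (toℕ j))
        ≈⟨ sum-cong-≋ {suc n} (λ j → *-congʳ {atPower p γ (toℕ j)} (atPower-degree1 degree (n ∸ toℕ j))) ⟩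
      ∑[ j ≤ n ] (β p ^ (n ∸ toℕ j) * atPower p γ (toℕ j)) ∎

    -‿sum-parameters : ∀ {γ γ⁻¹} → InverseAt p γ γ⁻¹ →
      ∀ s → s 0 ≈ - 1# → ParametersAt p γ⁻¹ s → ∀ b n →
      - (∑[ j ≤ n ] (b ^ (n ∸ toℕ j) * s (toℕ j))) ≈ ∑[ j ≤ n ] (b ^ (n ∸ toℕ j) * atPower p γ (toℕ j))
    -‿sum-parameters {γ} inverse s s₀≈-1 isParameter b n = begin
      - (∑[ j ≤ n ] (b ^ (n ∸ toℕ j) * s (toℕ j)))
        ≈⟨ -‿sum {suc n} (λ j → b ^ (n ∸ toℕ j) * s (toℕ j)) ⟩
      ∑[ j ≤ n ] (- (b ^ (n ∸ toℕ j) * s (toℕ j)))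
        ≈⟨ sum-cong-≋ {suc n} (λ j → trans (-‿distribʳ-* (b ^ (n ∸ toℕ j)) (s (toℕ j)))
             (*-congˡ (sym (atPower-inverse inverse s s₀≈-1 isParameter (toℕ j))))) ⟩
      ∑[ j ≤ n ] (b ^ (n ∸ toℕ j) * atPower p γ (toℕ j)) ∎

-- The two formulas over the complex numbers.

open import Defs

theorem11 :
  (p : ℕ) .{{_ : NonZero p}} → Prime p →
  (k : ℕ) → 2 ≤ k →
  (α β γ γ⁻¹ : ArithmeticFunction) →
  IsMultiplicative α → IsMultiplicative β → IsMultiplicative γ → IsMultiplicative γ⁻¹ →
  AgreeAt p α (β ∗ γ) →
  DegreeAt p 1 β →
  InverseAt p γ γ⁻¹ →
  (γ⁻¹-positive : PositiveAt p (k ∸ 1) γ⁻¹) →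
  NonTrivialAt p α →
  (η : Vector ArithmeticFunction (k ∸ 1)) →
  (∀ i → InverseAt p (PositiveAt.factor γ⁻¹-positive i) (η i)) →
  NormalFormAt p (β ∷ η) →
  (s : ℕ → ℂ) → s 0 ≈ - 1# → ParametersAt p γ⁻¹ s →
  (n : ℕ) →
  (atPower p α n ≈ - (∑[ j ≤ n ] (β p ^ (n ∸ toℕ j) * s (toℕ j)))) ×
  (- (∑[ j ≤ n ] (β p ^ (n ∸ toℕ j) * s (toℕ j)))
    ≈ ∑[ j ≤ n ] (β p ^ (n ∸ toℕ j) * atPower p γ (toℕ j)))
theorem11 p p-prime k 2≤k α β γ γ⁻¹ _ _ _ _ α≈β∗γ β-degree1 γ∗γ⁻¹≈ε _ _ η _ _ s s₀≈-1 s-parameters n =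
  -- The Cauchy product yields the sum over the values of `γ`; the second equality, read backwards,
  -- turns it into the sum over the parameters.
  trans (α≈β∗γ n) (trans (atPower-degree1-∗ p-prime β-degree1 γ n) (sym -∑s≈∑γ)) , -∑s≈∑γ
  where
  open CommutativeRing ℂ-commutativeRing using (trans; sym)
  open LocalFunctions ℂ-commutativeRing using (atPower-degree1-∗; -‿sum-parameters)

  -∑s≈∑γ = -‿sum-parameters p-prime γ∗γ⁻¹≈ε s s₀≈-1 s-parameters (β p) n
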